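{- Let $n\geq 2$. For every integer $k$ with $0\leq k\leq (n-2)!$ there exists a u-word for $n$-permutations with incomparable elements at distance $n-1$ (in the sense defined in the context) of length $n!+(1-k)(n-1)$. In other words, such u-words exist of each of the lengths $n!+n-1,\ n!,\ n!-(n-1),\ \ldots,\ n!-(n-1)!+n-1$.
   Context: An $n$-permutation is a permutation $\pi=\pi_1\cdots\pi_n$ of $\{1,\ldots,n\}$. Let $w=w_1\cdots w_n$ be a word of length $n$ over the positive integers, where letters may repeat; equal letters are treated as incomparable. The word $w$ covers the $n$-permutation $\pi$ if for all $i,j\in\{1,\ldots,n\}$, $w_i<w_j$ implies $\pi_i<\pi_j$ (that is, $\pi$ is a linear extension of the partial order on positions induced by $w$, in which positions holding equal letters are incomparable). For example, $112$ covers $123$ and $213$. A u-word (universal word) for $n$-permutations is a finite word $u=u_1\cdots u_N$ over the positive integers with $N\geq n$ such that every $n$-permutation is covered by exactly one of the $N-n+1$ factors $u_iu_{i+1}\cdots u_{i+n-1}$, $1\leq i\leq N-n+1$. The u-word uses incomparable elements at distance $n-1$ if whenever $u_i=u_j$ with $i<j$, we have $j-i\geq n-1$ (so inside any factor of length $n$ only the first and last letters can be equal). -}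

module Defs where

open import Data.Nat using (ℕ; suc; _+_; _∸_; _≤_; _<_)
open import Data.Nat.Properties using (+-mono-≤-<; m∸n+n≡m; module ≤-Reasoning)
open import Data.Fin using (Fin; toℕ; fromℕ<)
import Data.Fin as Fin
open import Data.Fin.Properties using (toℕ<n; toℕ≤pred[n])
open import Data.Fin.Permutation using (Permutation′; _⟨$⟩ʳ_)
open import Data.Product using (Σ-syntax; ∃!; _×_)
open import Data.Vec using (Vec; lookup; tabulate)
open import Data.Vec.Relation.Unary.All using (All)
open import Relation.Binary.PropositionalEquality using (_≡_)

-- Positions and permutation values are 0-based (Fin n stands for {1,…,n});
-- letters are genuine positive integers, enforced by Positive.

Word : ℕ → Set
Word N = Vec ℕ N

Positive : ∀ {N} → Word N → Set
Positive = All (1 ≤_)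

Covers : ∀ {n} → Word n → Permutation′ n → Set
Covers w π = ∀ i j → lookup w i < lookup w j → (π ⟨$⟩ʳ i) Fin.< (π ⟨$⟩ʳ j)

factor-bound : ∀ {n N} → n ≤ N → (i : Fin (suc (N ∸ n))) (j : Fin n) → toℕ i + toℕ j < N
factor-bound {n} {N} n≤N i j = begin-strict
  toℕ i + toℕ j  <⟨ +-mono-≤-< (toℕ≤pred[n] i) (toℕ<n j) ⟩
  (N ∸ n) + n    ≡⟨ m∸n+n≡m n≤N ⟩
  N              ∎
  where open ≤-Reasoning

factor : ∀ {n N} → n ≤ N → Word N → Fin (suc (N ∸ n)) → Word n
factor n≤N u i = tabulate λ j → lookup u (fromℕ< (factor-bound n≤N i j))

-- Uniqueness is of the starting position, so equal factors occurring at
-- different positions count as different factors.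
IsUWord : ∀ n {N} → Word N → Set
IsUWord n {N} u =
  Positive u ×
  (Σ[ n≤N ∈ n ≤ N ] ((π : Permutation′ n) → ∃! _≡_ λ i → Covers (factor n≤N u i) π))

IncomparableAtDistance : ∀ d {N} → Word N → Set
IncomparableAtDistance d {N} u =
  (i j : Fin N) → i Fin.< j → lookup u i ≡ lookup u j → d ≤ toℕ j ∸ toℕ i

{-# OPTIONS --safe #-}
module Submission where

-- Put m = n − 1. Regard each n-permutation as an edge from the order type of its first m letters to
-- the order type of its last m letters. Every order type x has exactly two edges to its rotation: the new
-- letter lies just below or just above the letter it replaces, and a factor whose first and last
-- letters are equal covers precisely these two permutations. The rotation splits the m! order types
-- into (n − 2)! cycles of length m; identifying the two edges along k whole cycles keeps the
-- graph balanced and connected, so it has an Eulerian circuit with n! − k m edges. Written out as a word,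
-- with all letters doubled at each step to make room for a new one, the circuit has m more letters.

open import Data.Nat using (ℕ; zero; suc; _+_; _*_; _∸_; _⊔_; _≤_; _<_; _≤?_; _<?_; z≤n; s≤s; s≤s⁻¹; z<s; s<s; s<s⁻¹; _!)
open import Data.Nat.Properties hiding (_≟_)
open import Data.Nat.GeneralisedArithmetic using (fold; fold-+)
open import Data.Integer using (+_; 1ℤ) renaming (_+_ to _+ℤ_; _-_ to _-ℤ_; _*_ to _*ℤ_)
import Data.Integer.Properties as ℤ
import Data.Integer.Tactic.RingSolver as ℤ-Solver
open import Data.Fin using (Fin; zero; suc; toℕ; fromℕ<; inject₁; punchIn; pinch; cast)
open import Data.Fin.Properties using (_≟_; toℕ-injective; toℕ-inject₁; toℕ≤pred[n]; toℕ<n; toℕ-fromℕ<; toℕ-cast; punchInᵢ≢i)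
open import Data.Fin.Permutation using (Permutation′; _⟨$⟩ʳ_; _⟨$⟩ˡ_; inverseˡ)
open import Data.List using (List; []; _∷_; _++_; map; length; lookup; filter; take; allFin; cartesianProductWith)
import Data.List.Properties as List
open import Data.List.Membership.Propositional using (_∈_; _∉_; find; lose)
open import Data.List.Membership.Propositional.Properties using (∈-∃++; ∈-map⁺; ∈-map⁻; ∈-++⁺ˡ; ∈-++⁺ʳ; ∈-++⁻; ∈-filter⁺; ∈-filter⁻; ∈-lookup; ∈-allFin; ∈-cartesianProductWith⁺; ∈-cartesianProductWith⁻)
open import Data.List.Membership.Propositional.Properties.WithK using (unique∧set⇒bag)
open import Data.List.Relation.Binary.BagAndSetEquality using (∼bag⇒↭)
open import Data.List.Relation.Binary.Permutation.Propositional using (_↭_; ↭-refl; ↭-sym; ↭-trans; ↭-reflexive; ↭⇒↭ₛ; prep; swap)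
open import Data.List.Relation.Binary.Permutation.Propositional.Properties using (∈-resp-↭; ↭-length; map⁺; drop-∷; shift; ++⁺ˡ; ++⁺ʳ; ++-comm)
import Data.List.Relation.Binary.Permutation.Setoid.Properties as PermutationSetoid
import Data.List.Relation.Unary.All as All
open import Data.List.Relation.Unary.AllPairs using ([]; _∷_)
open import Data.List.Relation.Unary.Any using (here; there; any?; index)
open import Data.List.Relation.Unary.Any.Properties using (lookup-index)
open import Data.List.Relation.Unary.Unique.Propositional using (Unique)
import Data.List.Relation.Unary.Unique.Propositional.Properties as Unique
open import Data.Product using (Σ-syntax; ∃; _×_; _,_; proj₁; proj₂)
open import Data.Sum using (_⊎_; inj₁; inj₂)
open import Data.Empty using (⊥-elim)
open import Data.Vec using (tabulate)
import Data.Vec as Vec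
open import Data.Vec.Properties using (lookup∘tabulate)
import Data.Vec.Relation.Unary.All.Properties as VecAll
open import Function using (_∘_; id; mk⇔)
open import Relation.Binary.Definitions using (DecidableEquality; tri<; tri≈; tri>)
open import Relation.Binary.PropositionalEquality using (_≡_; _≢_; refl; sym; trans; cong; cong₂; subst; subst₂; setoid; module ≡-Reasoning)
open import Relation.Nullary using (¬_; Dec; yes; no; ¬?)
open import Defs

-- Lists up to permutation

unique-↭ : ∀ {A : Set} {xs ys : List A} → Unique xs → Unique ys →
  (∀ {x} → x ∈ xs → x ∈ ys) → (∀ {x} → x ∈ ys → x ∈ xs) → xs ↭ ys
unique-↭ u v f g = ∼bag⇒↭ (unique∧set⇒bag u v (mk⇔ f g))

++-cancelˡ-↭ : ∀ {A : Set} {xs xs′ ys zs : List A} → xs ↭ xs′ → xs ++ ys ↭ xs′ ++ zs → ys ↭ zs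
++-cancelˡ-↭ {xs = xs} {xs′} {ys} {zs} p q = go xs (↭-trans q (++⁺ʳ zs (↭-sym p)))
  where
  go : ∀ xs → xs ++ ys ↭ xs ++ zs → ys ↭ zs
  go []       r = r
  go (_ ∷ xs) r = go xs (drop-∷ r)

∈-extract : ∀ {A : Set} {x : A} {xs} → x ∈ xs → ∃ λ ys → xs ↭ x ∷ ys
∈-extract x∈xs with ys , zs , refl ← ∈-∃++ x∈xs = ys ++ zs , shift _ ys zs

lookup-unique : ∀ {A : Set} {xs : List A} → Unique xs → ∀ i j → lookup xs i ≡ lookup xs j → i ≡ j
lookup-unique (_ ∷ _)  zero    zero    _  = refl
lookup-unique (x ∷ _)  zero    (suc j) eq = ⊥-elim (All.lookup x (∈-lookup j) eq)
lookup-unique (x ∷ _)  (suc i) zero    eq = ⊥-elim (All.lookup x (∈-lookup i) (sym eq))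
lookup-unique (_ ∷ xs) (suc i) (suc j) eq = cong suc (lookup-unique xs i j eq)

-- Eulerian circuits

module Euler {V E : Set} (_≟_ : DecidableEquality V) (src tgt : E → V) where

  open import Data.List.Membership.DecPropositional _≟_ using (_∈?_)

  data Trail : V → V → List E → Set where
    []  : ∀ {v} → Trail v v []
    _∷_ : ∀ e {z t} → Trail (tgt e) z t → Trail (src e) z (e ∷ t)

  _++ᵗ_ : ∀ {u v z s t} → Trail u v s → Trail v z t → Trail u z (s ++ t)
  []      ++ᵗ q = q
  (e ∷ p) ++ᵗ q = e ∷ (p ++ᵗ q)

  -- Both sides list the vertices visited by the trail, with multiplicity: the start and all
  -- targets, or all sources and the end.
  trail-balance : ∀ {v z t} → Trail v z t → v ∷ map tgt t ↭ z ∷ map src t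
  trail-balance []      = ↭-refl
  trail-balance (e ∷ p) = ↭-trans (prep (src e) (trail-balance p)) (swap _ _ ↭-refl)

  split-at : ∀ {u v z t} → Trail v z t → u ∈ v ∷ map tgt t →
    ∃ λ s₁ → ∃ λ s₂ → Trail v u s₁ × Trail u z s₂ × t ≡ s₁ ++ s₂
  split-at p (here refl) = _ , _ , [] , p , refl
  split-at (e ∷ p) (there u∈) with s₁ , s₂ , q₁ , q₂ , refl ← split-at p u∈ =
    _ , _ , e ∷ q₁ , q₂ , refl

  rotate-to : ∀ {u v t} → Trail v v t → u ∈ v ∷ map tgt t → ∃ λ t′ → Trail u u t′ × t′ ↭ t
  rotate-to p u∈ with s₁ , s₂ , q₁ , q₂ , refl ← split-at p u∈ = s₂ ++ s₁ , q₂ ++ᵗ q₁ , ++-comm s₂ s₁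

  -- Strong connectivity is phrased as induction on predecessors, so that it applies directly to the
  -- set of vertices on a trail, without any notion of path.
  module _ (L : List E)
           (connected : (P : V → Set) → (∀ {e} → e ∈ L → P (tgt e) → P (src e)) → ∀ {v} → P v → ∀ u → P u)
           where

    Circuit : Set
    Circuit = Σ[ v ∈ V ] Σ[ t ∈ List E ] Trail v v t × t ↭ L

    find-exit : ∀ {v t e R} → Trail v v t → t ++ e ∷ R ↭ L → ∃ λ f → f ∈ e ∷ R × tgt f ∈ v ∷ map tgt t
    find-exit {v} {t} {e} {R} p t+R
      with any? (λ f → tgt f ∈? (v ∷ map tgt t)) (e ∷ R)
    ... | yes some = find some
    ... | no none = ⊥-elim (none (here (connected (_∈ v ∷ map tgt t) closed (here refl) (tgt e))))
      where
      closed : ∀ {f} → f ∈ L → tgt f ∈ v ∷ map tgt t → src f ∈ v ∷ map tgt t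
      closed {f} f∈L tf∈ with ∈-++⁻ t (∈-resp-↭ (↭-sym t+R) f∈L)
      ... | inj₁ f∈t = ∈-resp-↭ (↭-sym (trail-balance p)) (there (∈-map⁺ src f∈t))
      ... | inj₂ f∈R = ⊥-elim (none (lose f∈R tf∈))

    -- Grow the trail at its front; whenever it closes up, restart it from a vertex with an unused incoming edge.
    extend : ∀ k {v z t R} → length R ≡ k → Trail v z t → t ++ R ↭ L → v ∷ map src R ↭ z ∷ map tgt R → Circuit
    prepend : ∀ k {v z t R f} → length R ≡ suc k → Trail v z t → t ++ R ↭ L → v ∷ map src R ↭ z ∷ map tgt R →
      f ∈ R → tgt f ≡ v → Circuit

    extend k {v} {z} len p t+R bal with v ≟ z
    extend k {R = []} len p t+R bal | yes refl = _ , _ , p , subst (_↭ L) (List.++-identityʳ _) t+R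
    extend (suc k) {R = e ∷ R} len p t+R bal | yes refl
      with f , f∈ , tf∈ ← find-exit p t+R
      with t′ , p′ , t′↭t ← rotate-to p tf∈ =
        prepend k len p′ (↭-trans (++⁺ʳ _ t′↭t) t+R) (prep (tgt f) (drop-∷ bal)) f∈ refl
    extend k {R = R} len p t+R bal | no v≢z with ∈-resp-↭ bal (here refl)
    ... | here v≡z = ⊥-elim (v≢z v≡z)
    extend zero {R = []} len p t+R bal | no v≢z | there ()
    extend (suc k) {R = R} len p t+R bal | no v≢z | there v∈
      with f , f∈ , eq ← ∈-map⁻ tgt v∈ = prepend k len p t+R bal f∈ (sym eq)

    prepend k {v} {z} {t} {R} {f} len p t+R bal f∈ refl
      with R′ , R↭ ← ∈-extract f∈ =
      extend k (suc-injective (trans (sym (↭-length R↭)) len)) (f ∷ p)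
        (↭-trans (↭-trans (↭-sym (shift f t R′)) (++⁺ˡ t (↭-sym R↭))) t+R)
        (drop-∷ (↭-trans (↭-trans (prep (tgt f) (map⁺ src (↭-sym R↭))) bal)
                         (↭-trans (prep z (map⁺ tgt R↭)) (swap _ _ ↭-refl))))

    circuit : V → map src L ↭ map tgt L → Circuit
    circuit v bal = extend (length L) refl ([] {v}) ↭-refl (prep v bal)

-- Order types of words: each letter is recorded by its rank among the letters to its right

infixr 5 _◃_ _▹_

-- The Lehmer code: every choice of ranks is allowed, so counting and deciding equality are
-- immediate.
data Code : ℕ → Set where
  ε   : Code 0
  _◃_ : ∀ {n} → Fin (suc n) → Code n → Code (suc n)

◃-injective : ∀ {n r s} {c d : Code n} → r ◃ c ≡ s ◃ d → r ≡ s × c ≡ d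
◃-injective refl = refl , refl

_≟ᶜ_ : ∀ {n} → DecidableEquality (Code n)
ε       ≟ᶜ ε       = yes refl
(r ◃ c) ≟ᶜ (s ◃ d) with r ≟ s | c ≟ᶜ d
... | yes refl | yes refl = yes refl
... | no r≢s   | _        = no (r≢s ∘ proj₁ ∘ ◃-injective)
... | _        | no c≢d   = no (c≢d ∘ proj₂ ∘ ◃-injective)

tail : ∀ {n} → Code (suc n) → Code n
tail (_ ◃ c) = c

codes : ∀ n → List (Code n)
codes zero    = ε ∷ []
codes (suc n) = cartesianProductWith _◃_ (allFin (suc n)) (codes n)

codes-complete : ∀ {n} (c : Code n) → c ∈ codes n
codes-complete ε       = here refl
codes-complete (r ◃ c) = ∈-cartesianProductWith⁺ _◃_ (∈-allFin r) (codes-complete c)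

codes-unique : ∀ n → Unique (codes n)
codes-unique zero    = All.[] ∷ []
codes-unique (suc n) = Unique.cartesianProductWith⁺ _◃_ ◃-injective (Unique.allFin⁺ (suc n)) (codes-unique n)

length-cartesianProductWith : ∀ {A B C : Set} (f : A → B → C) xs ys →
  length (cartesianProductWith f xs ys) ≡ length xs * length ys
length-cartesianProductWith f []       ys = refl
length-cartesianProductWith f (x ∷ xs) ys = trans (List.length-++ (map (f x) ys))
  (cong₂ _+_ (List.length-map (f x) ys) (length-cartesianProductWith f xs ys))

length-codes : ∀ n → length (codes n) ≡ n !
length-codes zero    = refl
length-codes (suc n) = trans (length-cartesianProductWith _◃_ (allFin (suc n)) (codes n))
  (cong₂ _*_ (List.length-tabulate {n = suc n} id) (length-codes n))

-- If the head has rank r among the other letters and the last letter has rank l once the head is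
-- removed, then deleting them in the opposite order gives ranks punchIn r l (last) and pinch l r (head).
lastRank : ∀ {n} → Code (suc n) → Fin (suc n)
lastRank {zero}  (r ◃ c) = r
lastRank {suc n} (r ◃ c) = punchIn r (lastRank c)

init : ∀ {n} → Code (suc n) → Code n
init {zero}  c       = ε
init {suc n} (r ◃ c) = pinch (lastRank c) r ◃ init c

-- The exchange rule above with the roles of head and last letter swapped.
snoc : ∀ {n} → Code n → Fin (suc n) → Code (suc n)
snoc ε       l = l ◃ ε
snoc (r ◃ c) l = punchIn l r ◃ snoc c (pinch r l)

-- Exchanging the order of two deletions twice restores both ranks; `pinch-punchIn` is the other
-- half.
punchIn-pinch : ∀ {n} (r : Fin (suc n)) (l : Fin n) → punchIn (punchIn r l) (pinch l r) ≡ r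
punchIn-pinch zero    zero    = refl
punchIn-pinch zero    (suc l) = refl
punchIn-pinch (suc r) zero    = refl
punchIn-pinch (suc r) (suc l) = cong suc (punchIn-pinch r l)

pinch-punchIn : ∀ {n} (r : Fin (suc n)) (l : Fin n) → pinch (pinch l r) (punchIn r l) ≡ l
pinch-punchIn zero    zero    = refl
pinch-punchIn zero    (suc l) = refl
pinch-punchIn (suc r) zero    with r
... | zero  = refl
... | suc _ = refl
pinch-punchIn (suc r) (suc l) = cong suc (pinch-punchIn r l)

snoc-init : ∀ {n} (c : Code (suc n)) → snoc (init c) (lastRank c) ≡ c
snoc-init {zero}  (r ◃ ε) = refl
snoc-init {suc n} (r ◃ c) = cong₂ _◃_ (punchIn-pinch r (lastRank c))
  (trans (cong (snoc (init c)) (pinch-punchIn r (lastRank c))) (snoc-init c))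

lastRank-snoc : ∀ {n} (c : Code n) l → lastRank (snoc c l) ≡ l
lastRank-snoc ε       l = refl
lastRank-snoc (r ◃ c) l = trans (cong (punchIn (punchIn l r)) (lastRank-snoc c (pinch r l))) (punchIn-pinch l r)

init-snoc : ∀ {n} (c : Code n) l → init (snoc c l) ≡ c
init-snoc ε       l = refl
init-snoc (r ◃ c) l = cong₂ _◃_
  (trans (cong (λ l′ → pinch l′ (punchIn l r)) (lastRank-snoc c (pinch r l))) (pinch-punchIn l r))
  (init-snoc c (pinch r l))

-- Moves the last letter to the front: its rank among the other letters does not depend on its
-- position.
rot : ∀ {n} → Code (suc n) → Code (suc n)
rot c = lastRank c ◃ init c

unrot : ∀ {n} → Code (suc n) → Code (suc n)
unrot (r ◃ c) = snoc c r

unrot-rot : ∀ {n} (c : Code (suc n)) → unrot (rot c) ≡ c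
unrot-rot = snoc-init

rot-unrot : ∀ {n} (c : Code (suc n)) → rot (unrot c) ≡ c
rot-unrot (r ◃ c) = cong₂ _◃_ (lastRank-snoc c r) (init-snoc c r)

rot-injective : ∀ {n} {c d : Code (suc n)} → rot c ≡ rot d → c ≡ d
rot-injective {c = c} {d} eq = trans (sym (unrot-rot c)) (trans (cong unrot eq) (unrot-rot d))

rot-codes : ∀ n → map rot (codes (suc n)) ↭ codes (suc n)
rot-codes n = unique-↭ (Unique.map⁺ rot-injective (codes-unique _)) (codes-unique _)
  (λ _ → codes-complete _)
  (λ {c} _ → subst (_∈ map rot (codes (suc n))) (rot-unrot c) (∈-map⁺ rot (codes-complete (unrot c))))

-- Words as prefixes of sequences, and their codes

Seq : Set
Seq = ℕ → ℕ

_▹_ : ℕ → Seq → Seq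
(a ▹ w) zero    = a
(a ▹ w) (suc i) = w i

-- A word of length m is the prefix of an infinite sequence, so that passing to a factor is a mere
-- shift of the index.
Distinct : ℕ → Seq → Set
Distinct m w = ∀ {i j} → i < j → j < m → w i ≢ w j

distinct-≢ : ∀ {m w i j} → Distinct m w → i < m → j < m → i ≢ j → w i ≢ w j
distinct-≢ {i = i} {j} D i<m j<m i≢j eq with <-cmp i j
... | tri< i<j _ _ = D i<j j<m eq
... | tri≈ _ i≡j _ = i≢j i≡j
... | tri> _ _ j<i = D j<i i<m (sym eq)

distinct-tail : ∀ {m w} → Distinct (suc m) w → Distinct m (w ∘ suc)
distinct-tail D i<j j<m = D (s<s i<j) (s<s j<m)

distinct-init : ∀ {m w} → Distinct (suc m) w → Distinct m w
distinct-init D i<j j<m = D i<j (m<n⇒m<1+n j<m)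

distinct-▹ : ∀ {m a w} → (∀ {j} → j < m → a ≢ w j) → Distinct m w → Distinct (suc m) (a ▹ w)
distinct-▹ a∉ D {zero}  {suc j} _   j<m = a∉ (s<s⁻¹ j<m)
distinct-▹ a∉ D {suc i} {suc j} i<j j<m = D (s<s⁻¹ i<j) (s<s⁻¹ j<m)

bump : ∀ {P : Set} {n} → Dec P → Fin n → Fin (suc n)
bump (yes _) = suc
bump (no _)  = inject₁

bump-yes : ∀ {P : Set} {n} (d : Dec P) (r : Fin n) → P → bump d r ≡ suc r
bump-yes (yes _) r p = refl
bump-yes (no ¬p) r p = ⊥-elim (¬p p)

bump-no : ∀ {P : Set} {n} (d : Dec P) (r : Fin n) → ¬ P → bump d r ≡ inject₁ r
bump-no (yes p) r ¬p = ⊥-elim (¬p p)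
bump-no (no _)  r ¬p = refl

bump-comm : ∀ {P Q : Set} {n} (d : Dec P) (e : Dec Q) (r : Fin n) → bump d (bump e r) ≡ bump e (bump d r)
bump-comm (yes _) (yes _) r = refl
bump-comm (yes _) (no _)  r = refl
bump-comm (no _)  (yes _) r = refl
bump-comm (no _)  (no _)  r = refl

-- The offset `k` serves two comparisons: 0 in `rank-mono` and 1 in `rank-strict`.
toℕ-bump : ∀ {P Q : Set} {m n} (d : Dec P) (e : Dec Q) (r : Fin m) (s : Fin n) k →
  (P → Q) → k + toℕ r ≤ toℕ s → k + toℕ (bump d r) ≤ toℕ (bump e s)
toℕ-bump (yes _) (yes _) r s k f le rewrite +-suc k (toℕ r) = s≤s le
toℕ-bump (yes p) (no ¬q) r s k f le = ⊥-elim (¬q (f p))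
toℕ-bump (no _)  (yes _) r s k f le rewrite toℕ-inject₁ r = m≤n⇒m≤1+n le
toℕ-bump (no _)  (no _)  r s k f le rewrite toℕ-inject₁ r | toℕ-inject₁ s = le

rank : ∀ m → ℕ → Seq → Fin (suc m)
rank zero    a w = zero
rank (suc m) a w = bump (w 0 <? a) (rank m a (w ∘ suc))

rank-mono : ∀ m {a b w v} → (∀ {j} → j < m → w j < a → v j < b) → toℕ (rank m a w) ≤ toℕ (rank m b v)
rank-mono zero    f = z≤n
rank-mono (suc m) {a} {b} {w} {v} f =
  toℕ-bump (w 0 <? a) (v 0 <? b) _ _ 0 (f z<s) (rank-mono m (f ∘ s<s))

rank-strict : ∀ m {a b w v k} → (∀ {j} → j < m → w j < a → v j < b) →
  k < m → ¬ (w k < a) → v k < b → toℕ (rank m a w) < toℕ (rank m b v)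
rank-strict (suc m) {a} {b} {w} {v} {zero} f _ ¬p q
  rewrite bump-no (w 0 <? a) (rank m a (w ∘ suc)) ¬p | bump-yes (v 0 <? b) (rank m b (v ∘ suc)) q
        | toℕ-inject₁ (rank m a (w ∘ suc)) = s≤s (rank-mono m (f ∘ s<s))
rank-strict (suc m) {a} {b} {w} {v} {suc k} f k<m ¬p q =
  toℕ-bump (w 0 <? a) (v 0 <? b) _ _ 1 (f z<s) (rank-strict m (f ∘ s<s) (s<s⁻¹ k<m) ¬p q)

rank-cong : ∀ m {a b w v} → (∀ {j} → j < m → w j < a → v j < b) → (∀ {j} → j < m → v j < b → w j < a) →
  rank m a w ≡ rank m b v
rank-cong m f g = toℕ-injective (≤-antisym (rank-mono m f) (rank-mono m g))

rank-zero : ∀ m {a w j} → rank m a w ≡ zero → j < m → ¬ (w j < a)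
rank-zero (suc m) {a} {w} {j} eq j<m p
  with toℕ (rank (suc m) a w) | cong toℕ eq | rank-strict (suc m) {0} {a} {w} {w} (λ _ ()) j<m (λ ()) p
... | _ | refl | ()

rank-last : ∀ m a w → rank (suc m) a w ≡ bump (w m <? a) (rank m a w)
rank-last zero    a w = refl
rank-last (suc m) a w = trans (cong (bump (w 0 <? a)) (rank-last m a (w ∘ suc)))
  (bump-comm (w 0 <? a) (w (suc m) <? a) _)

code : ∀ m → Seq → Code m
code zero    w = ε
code (suc m) w = rank m (w 0) (w ∘ suc) ◃ code m (w ∘ suc)

-- The relation `Covers` for sequences, with `v` in the place of the permutation.
OrderHom : ℕ → Seq → Seq → Set
OrderHom m w v = ∀ {i j} → i < m → j < m → w i < w j → v i < v j

hom-tail : ∀ {m w v} → OrderHom (suc m) w v → OrderHom m (w ∘ suc) (v ∘ suc)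
hom-tail f i<m j<m = f (s<s i<m) (s<s j<m)

code-cong : ∀ m {w v} → OrderHom m w v → OrderHom m v w → code m w ≡ code m v
code-cong zero    f g = refl
code-cong (suc m) {w} {v} f g = cong₂ _◃_
  (rank-cong m (λ j<m → f (s<s j<m) z<s) (λ j<m → g (s<s j<m) z<s)) (code-cong m (hom-tail {w = w} {v} f) (hom-tail {w = v} {w} g))

-- Distinct letters are totally ordered, so `w` leaves no comparison of `v` undecided.
hom-reverse : ∀ {m w v} → Distinct m w → OrderHom m w v → OrderHom m v w
hom-reverse {m} {w} {v} D f {i} {j} i<m j<m vi<vj with <-cmp (w i) (w j)
... | tri< p _ _ = p
... | tri> _ _ p = ⊥-elim (<-asym vi<vj (f j<m i<m p))
... | tri≈ _ p _ = ⊥-elim (distinct-≢ {w = w} D i<m j<m (λ { refl → <-irrefl refl vi<vj }) p)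

hom⇒code≡ : ∀ m {w v} → Distinct m w → OrderHom m w v → code m w ≡ code m v
hom⇒code≡ m {w} {v} D f = code-cong m {w} {v} f (hom-reverse {w = w} {v} D f)

-- The tails agree by induction. Were the heads placed differently against them, the positions below
-- one head would form a proper subset of those below the other, against equal ranks.
code≡⇒hom : ∀ m {w v} → Distinct m w → Distinct m v → code m w ≡ code m v → OrderHom m w v
code≡⇒hom (suc m) {w} {v} Dw Dv eq {i} {j} = go i j
  where
  IH : OrderHom m (w ∘ suc) (v ∘ suc)
  IH = code≡⇒hom m (distinct-tail {w = w} Dw) (distinct-tail {w = v} Dv) (proj₂ (◃-injective eq))
  IH⁻¹ : OrderHom m (v ∘ suc) (w ∘ suc)
  IH⁻¹ = code≡⇒hom m (distinct-tail {w = v} Dv) (distinct-tail {w = w} Dw) (sym (proj₂ (◃-injective eq)))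
  ranks : toℕ (rank m (w 0) (w ∘ suc)) ≡ toℕ (rank m (v 0) (v ∘ suc))
  ranks = cong toℕ (proj₁ (◃-injective eq))
  go : ∀ i j → i < suc m → j < suc m → w i < w j → v i < v j
  go zero    zero    _ _ p = ⊥-elim (<-irrefl refl p)
  go (suc i) (suc j) i<m j<m p = IH (s<s⁻¹ i<m) (s<s⁻¹ j<m) p
  go (suc i) zero    i<m _ p with v (suc i) <? v 0
  ... | yes q = q
  ... | no ¬q = ⊥-elim (<-irrefl (sym ranks)
    (rank-strict m (λ k<m vk<v0 → <-trans (IH⁻¹ k<m (s<s⁻¹ i<m) (<-≤-trans vk<v0 (≮⇒≥ ¬q))) p) (s<s⁻¹ i<m) ¬q p))
  go zero (suc j) _ j<m p with <-cmp (v 0) (v (suc j))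
  ... | tri< q _ _ = q
  ... | tri≈ _ q _ = ⊥-elim (Dv z<s j<m q)
  ... | tri> _ _ q = ⊥-elim (<-irrefl ranks
    (rank-strict m (λ k<m wk<w0 → <-trans (IH k<m (s<s⁻¹ j<m) (<-trans wk<w0 p)) q) (s<s⁻¹ j<m) (<-asym p) q))

-- The exchange rule when the head lies below the last letter: only the rank of the last letter
-- counts the other one. `punchIn-≥` is the opposite case.
punchIn-≤ : ∀ {n} (r l : Fin n) → toℕ r ≤ toℕ l → punchIn (inject₁ r) l ≡ suc l × pinch l (inject₁ r) ≡ r
punchIn-≤ zero    zero    le = refl , refl
punchIn-≤ zero    (suc l) le = refl , refl
punchIn-≤ (suc r) (suc l) le with p , q ← punchIn-≤ r l (s≤s⁻¹ le) = cong suc p , cong suc q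

punchIn-≥ : ∀ {n} (r l : Fin n) → toℕ l ≤ toℕ r → punchIn (suc r) l ≡ inject₁ l × pinch l (suc r) ≡ r
punchIn-≥ r       zero    le = refl , refl
punchIn-≥ (suc r) (suc l) le with p , q ← punchIn-≥ r l (s≤s⁻¹ le) = cong suc p , cong suc q

-- Justifies the recursions for `lastRank` and `init`: comparing the head with the last letter tells
-- which case of the exchange rule applies.
code-snoc : ∀ m {w} → Distinct (suc m) w →
  lastRank (code (suc m) w) ≡ rank m (w m) w × init (code (suc m) w) ≡ code m w
code-snoc zero    D = refl , refl
code-snoc (suc m) {w} D with IHl , IHi ← code-snoc m {w ∘ suc} (distinct-tail {w = w} D)
  rewrite IHl | IHi | rank-last m (w 0) (w ∘ suc) with <-cmp (w 0) (w (suc m))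
... | tri≈ _ p _ = ⊥-elim (D z<s ≤-refl p)
... | tri< p _ ¬q
  rewrite bump-no (w (suc m) <? w 0) (rank m (w 0) (w ∘ suc)) ¬q
        | bump-yes (w 0 <? w (suc m)) (rank m (w (suc m)) (w ∘ suc)) p
  with e , f ← punchIn-≤ (rank m (w 0) (w ∘ suc)) (rank m (w (suc m)) (w ∘ suc)) (rank-mono m (λ _ q → <-trans q p))
  = e , cong (_◃ code m (w ∘ suc)) f
... | tri> ¬p _ q
  rewrite bump-yes (w (suc m) <? w 0) (rank m (w 0) (w ∘ suc)) q
        | bump-no (w 0 <? w (suc m)) (rank m (w (suc m)) (w ∘ suc)) ¬p
  with e , f ← punchIn-≥ (rank m (w 0) (w ∘ suc)) (rank m (w (suc m)) (w ∘ suc)) (rank-mono m (λ _ p → <-trans p q))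
  = e , cong (_◃ code m (w ∘ suc)) f

-- This is why a factor with equal ends follows a rotation edge: the repeated letter is last in one
-- window and first in the other.
code-rot : ∀ p {w} → Distinct (suc p) (w ∘ suc) → w 0 ≡ w (suc p) → code (suc p) w ≡ rot (code (suc p) (w ∘ suc))
code-rot p {w} D eq with e , f ← code-snoc p {w ∘ suc} D =
  cong₂ _◃_ (trans (cong (λ a → rank p a (w ∘ suc)) eq) (sym e)) (sym f)

-- Inserting letters of prescribed rank

double-hom : ∀ m w → OrderHom m w (λ i → 2 * w i)
double-hom m w _ _ = *-monoʳ-< 2

double-distinct : ∀ {m w} → Distinct m w → Distinct m (λ i → 2 * w i)
double-distinct D i<j j<m eq = D i<j j<m (*-cancelˡ-≡ _ _ 2 eq)

code-double : ∀ m w → code m (λ i → 2 * w i) ≡ code m w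
code-double m w = code-cong m (λ _ _ → *-cancelˡ-< 2 _ _) (double-hom m w)

-- Raising the threshold by one admits only the letter `a` itself, which occurs at most once.
rank-step : ∀ m a {w} → Distinct m w → toℕ (rank m (suc a) w) ≤ suc (toℕ (rank m a w))
rank-step zero    a     D = z≤n
rank-step (suc m) a {w} D with <-cmp (w 0) a
... | tri< p _ _
  rewrite bump-yes (w 0 <? suc a) (rank m (suc a) (w ∘ suc)) (m<n⇒m<1+n p)
        | bump-yes (w 0 <? a) (rank m a (w ∘ suc)) p
  = s≤s (rank-step m a (distinct-tail {w = w} D))
... | tri> ¬p ¬e q
  rewrite bump-no (w 0 <? suc a) (rank m (suc a) (w ∘ suc)) (≤⇒≯ q)
        | bump-no (w 0 <? a) (rank m a (w ∘ suc)) ¬p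
        | toℕ-inject₁ (rank m (suc a) (w ∘ suc)) | toℕ-inject₁ (rank m a (w ∘ suc))
  = rank-step m a (distinct-tail {w = w} D)
... | tri≈ ¬p refl _
  rewrite bump-yes (w 0 <? suc a) (rank m (suc a) (w ∘ suc)) ≤-refl
        | bump-no (w 0 <? a) (rank m a (w ∘ suc)) ¬p
        | toℕ-inject₁ (rank m a (w ∘ suc))
  = s≤s (rank-mono m λ j<m q → ≤∧≢⇒< (s≤s⁻¹ q) (λ eq → D z<s (s<s j<m) (sym eq)))

rank-full : ∀ m w → ∃ λ b → ∀ {a} → b ≤ a → toℕ (rank m (suc a) w) ≡ m
rank-full zero    w = 0 , λ _ → refl
rank-full (suc m) w with b , f ← rank-full m (w ∘ suc) = w 0 ⊔ b , λ {a} le →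
  trans (cong toℕ (bump-yes (w 0 <? suc a) (rank m (suc a) (w ∘ suc)) (s≤s (m⊔n≤o⇒m≤o _ _ le)))) (cong suc (f (m⊔n≤o⇒n≤o _ _ le)))

-- A discrete intermediate value argument: the rank is m at a large threshold, 0 at threshold 1
-- since letters are positive, and changes by at most one per step. The threshold `suc b`
-- corresponds to the letter `suc (2 * b)` among doubled letters.
rank-surjective : ∀ m {w} → Distinct m w → (∀ i → 1 ≤ w i) → (r : Fin (suc m)) → ∃ λ b → rank m (suc b) w ≡ r
rank-surjective m {w} D pos r with b , f ← rank-full m w =
  go b (subst (toℕ r ≤_) (sym (f ≤-refl)) (toℕ≤pred[n] r))
  where
  go : ∀ b → toℕ r ≤ toℕ (rank m (suc b) w) → ∃ λ b → rank m (suc b) w ≡ r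
  go zero le = 0 , toℕ-injective (≤-antisym
    (≤-trans (rank-mono m {1} {0} {w} {w} (λ {j} _ p → ⊥-elim (<⇒≱ p (pos j)))) (subst (_≤ toℕ r) (sym (rank-0 m w)) z≤n)) le)
    where
    rank-0 : ∀ m w → toℕ (rank m 0 w) ≡ 0
    rank-0 zero w = refl
    rank-0 (suc m) w = trans (toℕ-inject₁ (rank m 0 (w ∘ suc))) (rank-0 m (w ∘ suc))
  go (suc b) le with toℕ r <? suc (toℕ (rank m (suc b) w))
  ... | yes p = go b (s≤s⁻¹ p)
  ... | no ¬p = suc b , toℕ-injective (≤-antisym (≤-trans (rank-step m (suc b) D) (≮⇒≥ ¬p)) le)

-- Doubling all letters makes room for a new odd letter of any prescribed rank.
fresh-letter : ∀ m {w} → Distinct m w → (∀ i → 1 ≤ w i) → (r : Fin (suc m)) →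
  ∃ λ b → Distinct (suc m) (suc (2 * b) ▹ λ i → 2 * w i) ×
          code (suc m) (suc (2 * b) ▹ λ i → 2 * w i) ≡ r ◃ code m w
fresh-letter m {w} D pos r with b , eq ← rank-surjective m D pos r =
  b , distinct-▹ (λ {j} _ e → even≢odd (w j) b (sym e)) (double-distinct D) ,
  cong₂ _◃_ (trans (rank-cong m (λ _ p → s≤s (*-cancelˡ-≤ 2 (s≤s⁻¹ p))) (λ _ p → s≤s (*-monoʳ-≤ 2 (s≤s⁻¹ p)))) eq) (code-double m w)

double-positive : ∀ {w : Seq} → (∀ i → 1 ≤ w i) → ∀ i → 1 ≤ 2 * w i
double-positive pos i = ≤-trans (pos i) (m≤m+n _ _)

code-surjective : ∀ {m} (c : Code m) → ∃ λ w → (∀ i → 1 ≤ w i) × Distinct m w × code m w ≡ c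
code-surjective ε = (λ _ → 1) , (λ _ → ≤-refl) , (λ _ ()) , refl
code-surjective {suc m} (r ◃ c) with w , pos , D , refl ← code-surjective c
  with b , D′ , eq ← fresh-letter m D pos r =
  _ , (λ { zero → s≤s z≤n ; (suc i) → double-positive pos i }) , D′ , eq

-- Orbits of the rotation, each of size suc p

code-≗ : ∀ m {w v} → (∀ {j} → j < m → w j ≡ v j) → code m w ≡ code m v
code-≗ m eq = code-cong m (λ i<m j<m → subst₂ _<_ (eq i<m) (eq j<m))
  (λ i<m j<m → subst₂ _<_ (sym (eq i<m)) (sym (eq j<m)))

-- Rotates the first p + 1 letters while keeping the old sequence behind them: after i rounds the
-- original word is still readable from position i on.
cycle : ℕ → Seq → Seq
cycle p w = w p ▹ w

cycle-distinct : ∀ p {w} → Distinct (suc p) w → Distinct (suc p) (cycle p w)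
cycle-distinct p {w} D = distinct-▹ (λ j<p eq → D j<p ≤-refl (sym eq)) (distinct-init {w = w} D)

cycle^-code : ∀ p {w} → Distinct (suc p) w → ∀ i →
  Distinct (suc p) (fold w (cycle p) i) × code (suc p) (fold w (cycle p) i) ≡ fold (code (suc p) w) rot i
cycle^-code p D zero = D , refl
cycle^-code p {w} D (suc i) with D′ , eq ← cycle^-code p {w} D i =
  cycle-distinct p D′ , trans (code-rot p {cycle p (fold w (cycle p) i)} D′ refl) (cong rot eq)

cycle^-shift : ∀ p w i j → fold w (cycle p) i (i + j) ≡ w j
cycle^-shift p w zero    j = refl
cycle^-shift p w (suc i) j = cycle^-shift p w i j

cycle^-head : ∀ p w {i} → i ≤ p → fold w (cycle p) (suc i) 0 ≡ w (p ∸ i)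
cycle^-head p w {i} i≤p = trans (cong (fold w (cycle p) i) (sym (m+[n∸m]≡n i≤p))) (cycle^-shift p w i (p ∸ i))

cycle^-period : ∀ p w {j} → j ≤ p → fold w (cycle p) (suc p) j ≡ w j
cycle^-period p w {j} j≤p = begin
  -- The letter at position j at the end is the head after `suc (p ∸ j)` rounds, pushed back by j
  -- further rounds.
  fold w (cycle p) (suc p) j                         ≡⟨ cong (λ i → fold w (cycle p) i j) j+ ⟨
  fold w (cycle p) (j + suc (p ∸ j)) j               ≡⟨ cong (λ u → u j) (fold-+ w (cycle p) j) ⟩
  fold (fold w (cycle p) (suc (p ∸ j))) (cycle p) j j ≡⟨ cong (fold (fold w (cycle p) (suc (p ∸ j))) (cycle p) j) (+-identityʳ j) ⟨
  fold (fold w (cycle p) (suc (p ∸ j))) (cycle p) j (j + 0) ≡⟨ cycle^-shift p _ j 0 ⟩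
  fold w (cycle p) (suc (p ∸ j)) 0                   ≡⟨ cycle^-head p w (m∸n≤m p j) ⟩
  w (p ∸ (p ∸ j))                                    ≡⟨ cong w (m∸[m∸n]≡n j≤p) ⟩
  w j                                                ∎
  where
  open ≡-Reasoning
  j+ : j + suc (p ∸ j) ≡ suc p
  j+ = trans (+-suc j _) (cong suc (m+[n∸m]≡n j≤p))

rot^-period : ∀ {p} (c : Code (suc p)) → fold c rot (suc p) ≡ c
rot^-period {p} c with w , _ , D , refl ← code-surjective c =
  trans (sym (proj₂ (cycle^-code p {w} D (suc p)))) (code-≗ (suc p) (λ j<m → cycle^-period p w (s≤s⁻¹ j<m)))

-- A code of the form zero ◃ z puts the least letter first; the rotations in between have it elsewhere.
rot^-moves-zero : ∀ {p} (y z : Code p) {i} → i < p → zero ◃ y ≢ fold (zero ◃ z) rot (suc i)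
rot^-moves-zero {p} y z {i} i<p eq with w , _ , D , c≡ ← code-surjective (zero ◃ z) =
  rank-zero p (sym (proj₁ (◃-injective head≡))) i<p
    (subst₂ _<_ (trans (sym (cycle^-shift p w i 0)) (cong (fold w (cycle p) i) (+-identityʳ i)))
      (sym (cycle^-head p w (<⇒≤ i<p))) w0<)
  where
  head≡ : zero ◃ y ≡ code (suc p) (fold w (cycle p) (suc i))
  head≡ = trans eq (trans (cong (λ c → fold c rot (suc i)) (sym c≡)) (sym (proj₂ (cycle^-code p {w} D (suc i)))))
  w0< : w 0 < w (p ∸ i)
  w0< with p ∸ i | m<n⇒0<n∸m i<p | s≤s (m∸n≤m p i)
  ... | suc d | _ | d<p = ≤∧≢⇒< (≮⇒≥ (rank-zero p (proj₁ (◃-injective c≡)) (s<s⁻¹ d<p))) (D z<s d<p)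

rot^-injective : ∀ {p} i {c d : Code (suc p)} → fold c rot i ≡ fold d rot i → c ≡ d
rot^-injective zero    eq = eq
rot^-injective (suc i) eq = rot^-injective i (rot-injective eq)

-- Each cycle of the rotation has exactly one member with the least letter in front. The codes `z`
-- of the other p letters thus index the p ! = (n - 2)! cycles, and `i` runs along one cycle.
orbit : ∀ {p} → Fin (suc p) → Code p → Code (suc p)
orbit i z = fold (zero ◃ z) rot (toℕ i)

-- Cancelling the common rotations leaves fewer than a full turn between two representatives, and
-- `rot^-moves-zero` allows only the trivial one.
orbit-≤ : ∀ {p} {i j : Fin (suc p)} {y z : Code p} → toℕ i ≤ toℕ j → orbit i y ≡ orbit j z → i ≡ j × y ≡ z
orbit-≤ {p} {i} {j} {y} {z} i≤j eq = go (toℕ j ∸ toℕ i) refl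
  where
  eq′ : zero ◃ y ≡ fold (zero ◃ z) rot (toℕ j ∸ toℕ i)
  eq′ = rot^-injective (toℕ i) (trans eq (trans (cong (fold (zero ◃ z) rot) (sym (m+[n∸m]≡n i≤j))) (fold-+ (zero ◃ z) rot (toℕ i))))
  go : ∀ d → d ≡ toℕ j ∸ toℕ i → i ≡ j × y ≡ z
  go zero    d≡ = toℕ-injective (≤-antisym i≤j (m∸n≡0⇒m≤n (sym d≡))) ,
    proj₂ (◃-injective (trans eq′ (cong (fold (zero ◃ z) rot) (sym d≡))))
  go (suc d) d≡ = ⊥-elim (rot^-moves-zero y z
    (≤-trans (≤-reflexive d≡) (≤-trans (m∸n≤m (toℕ j) (toℕ i)) (s≤s⁻¹ (toℕ<n j))))
    (trans eq′ (cong (fold (zero ◃ z) rot) (sym d≡))))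

orbit-injective : ∀ {p} {i j : Fin (suc p)} {y z : Code p} → orbit i y ≡ orbit j z → i ≡ j × y ≡ z
orbit-injective {i = i} {j} eq with ≤-total (toℕ i) (toℕ j)
... | inj₁ i≤j = orbit-≤ i≤j eq
... | inj₂ j≤i with refl , refl ← orbit-≤ j≤i (sym eq) = refl , refl

orbits : ∀ {p} → List (Code p) → List (Code (suc p))
orbits {p} zs = cartesianProductWith orbit (allFin (suc p)) zs

orbits-unique : ∀ {p} {zs : List (Code p)} → Unique zs → Unique (orbits zs)
orbits-unique {p} = Unique.cartesianProductWith⁺ orbit orbit-injective (Unique.allFin⁺ (suc p))

∈-orbits : ∀ {p} {zs : List (Code p)} {z i} → z ∈ zs → i ≤ p → fold (zero ◃ z) rot i ∈ orbits zs
∈-orbits {p} {zs} {z} {i} z∈ i≤p = subst (λ i → fold (zero ◃ z) rot i ∈ orbits zs) (toℕ-fromℕ< (s≤s i≤p))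
  (∈-cartesianProductWith⁺ orbit (∈-allFin (fromℕ< (s≤s i≤p))) z∈)

rot-orbits : ∀ {p} {zs : List (Code p)} → Unique zs → map rot (orbits zs) ↭ orbits zs
rot-orbits {p} {zs} u = unique-↭ (Unique.map⁺ rot-injective (orbits-unique u)) (orbits-unique u) to from
  where
  to : ∀ {x} → x ∈ map rot (orbits zs) → x ∈ orbits zs
  to x∈ with y , y∈ , refl ← ∈-map⁻ rot x∈
    with i , z , _ , z∈ , refl ← ∈-cartesianProductWith⁻ orbit (allFin (suc p)) zs y∈
    with suc (toℕ i) ≤? p
  ... | yes i<p = ∈-orbits z∈ i<p
  -- The last member of a cycle rotates back to the representative.
  ... | no  i≮p = subst (_∈ orbits zs)
    (trans (sym (rot^-period (zero ◃ z)))
      (cong (λ i → rot (fold (zero ◃ z) rot i)) (≤-antisym (≮⇒≥ i≮p) (s≤s⁻¹ (toℕ<n i)))))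
    (∈-orbits z∈ z≤n)
  from : ∀ {x} → x ∈ orbits zs → x ∈ map rot (orbits zs)
  from x∈ with i , z , _ , z∈ , refl ← ∈-cartesianProductWith⁻ orbit (allFin (suc p)) zs x∈
    with toℕ i | toℕ<n i
  ... | zero  | _   = subst (_∈ map rot (orbits zs)) (rot^-period (zero ◃ z)) (∈-map⁺ rot (∈-orbits z∈ ≤-refl))
  ... | suc j | j<m = ∈-map⁺ rot (∈-orbits z∈ (<⇒≤ (s<s⁻¹ j<m)))

-- The overlap graph with the upper of the two edges rot x → x deleted for x in M

append : ℕ → Seq → Seq → Seq
append zero    v w = w
append (suc i) v w = v 0 ▹ append i (v ∘ suc) w

append-< : ∀ i v w {j} → j < i → append i v w j ≡ v j
append-< (suc i) v w {zero}  j<i = refl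
append-< (suc i) v w {suc j} j<i = append-< i (v ∘ suc) w (s<s⁻¹ j<i)

append-∌ : ∀ i {a v w} → (∀ {j} → j < i → a ≢ v j) → (∀ j → a ≢ w j) → ∀ j → a ≢ append i v w j
append-∌ zero    f g j       = g j
append-∌ (suc i) f g zero    = f z<s
append-∌ (suc i) f g (suc j) = append-∌ i (f ∘ s<s) g j

append-distinct : ∀ i {m v w} → Distinct i v → Distinct m w → (∀ i j → v i ≢ w j) → Distinct (i + m) (append i v w)
append-distinct zero    Dv Dw ne = Dw
append-distinct (suc i) {v = v} Dv Dw ne = distinct-▹
  (λ {j} _ → append-∌ i (λ j<i → Dv z<s (s<s j<i)) (ne 0) j)
  (append-distinct i (distinct-tail {w = v} Dv) Dw (ne ∘ suc))

-- From x one reaches y backwards by writing a word of order type y in front of one of order type x.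
overlap-connected : ∀ {p} (P : Code (suc p) → Set) → (∀ r {x} → P x → P (r ◃ init x)) → ∀ {x} → P x → ∀ y → P y
overlap-connected {p} P step {x} Px y
  with v , _ , Dv , refl ← code-surjective y | w , _ , Dw , refl ← code-surjective x =
  subst P (trans (code-≗ (suc p) (append-< (suc p) v′ w′)) (code-double (suc p) v))
    (go (suc p) v′ (append-distinct (suc p) {v = v′} {w′} (double-distinct Dv) Dw′ (λ i j → even≢odd (v i) (w j)))
      (subst P (code-cong (suc p) {w} {w′} (λ _ _ q → s≤s (*-monoʳ-< 2 q)) (λ _ _ q → *-cancelˡ-< 2 _ _ (s<s⁻¹ q))) Px))
  where
  -- Even letters for `y` and odd letters for `x` keep the joined word free of repetitions.
  v′ w′ : Seq
  v′ j = 2 * v j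
  w′ j = suc (2 * w j)
  Dw′ : Distinct (suc p) w′
  Dw′ i<j j<m eq = double-distinct Dw i<j j<m (suc-injective eq)
  go : ∀ i u → Distinct (i + suc p) (append i u w′) → P (code (suc p) w′) → P (code (suc p) (append i u w′))
  go zero    u D Pw = Pw
  go (suc i) u D Pw =
    subst (λ c → P (rank p (u 0) (append i (u ∘ suc) w′) ◃ c))
      (proj₂ (code-snoc p (λ a<b b<m → D′ a<b (<-≤-trans b<m (m≤n+m (suc p) i)))))
      (step _ (go i (u ∘ suc) D′ Pw))
    where
    D′ : Distinct (i + suc p) (append i (u ∘ suc) w′)
    D′ = distinct-tail {w = append (suc i) u w′} D

odd<even : ∀ {a b} → a < b → suc (2 * a) < 2 * b
odd<even {a} a<b = ≤-trans (≤-reflexive (sym (*-suc 2 a))) (*-monoʳ-≤ 2 a<b)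

-- Every rank `r` left after deleting the last letter arises from a head rank other than `suc l`,
-- the rank used by the deleted edge.
pinch-punchIn-suc : ∀ {n} (l r : Fin n) → pinch l (punchIn (suc l) r) ≡ r
pinch-punchIn-suc l       zero    = refl
pinch-punchIn-suc zero    (suc r) = refl
pinch-punchIn-suc (suc l) (suc r) = cong suc (pinch-punchIn-suc l r)

-- Without repetitions and invariant under `rot`, the list `M` is a union of cycles.
module Merged {p : ℕ} (M : List (Code (suc p))) (M-unique : Unique M) (M-rot : map rot M ↭ M) where

  open import Data.List.Membership.DecPropositional (_≟ᶜ_ {suc p}) using () renaming (_∈?_ to _∈ᵛ?_)
  open import Data.List.Membership.DecPropositional (_≟ᶜ_ {suc (suc p)}) using (_∈?_)

  -- A code of m + 1 letters is an edge from its `init` to its `tail`. In these two the head is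
  -- adjacent in value to the last letter of `x`.
  below above : Code (suc p) → Code (suc (suc p))
  below x = inject₁ (lastRank x) ◃ x
  above x = suc (lastRank x) ◃ x

  below≢above : ∀ {x y} → below x ≢ above y
  below≢above {x} {y} eq with e , refl ← ◃-injective eq =
    <-irrefl (trans (sym (toℕ-inject₁ (lastRank x))) (cong toℕ e)) ≤-refl

  init-below : ∀ x → init (below x) ≡ rot x
  init-below x = cong (_◃ init x) (proj₂ (punchIn-≤ (lastRank x) (lastRank x) ≤-refl))

  init-above : ∀ x → init (above x) ≡ rot x
  init-above x = cong (_◃ init x) (proj₂ (punchIn-≥ (lastRank x) (lastRank x) ≤-refl))

  dropped : List (Code (suc (suc p)))
  dropped = map above M

  edges : List (Code (suc (suc p)))
  edges = filter (λ e → ¬? (e ∈? dropped)) (codes (suc (suc p)))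

  ∈-edges : ∀ {e} → e ∉ dropped → e ∈ edges
  ∈-edges {e} = ∈-filter⁺ (λ e → ¬? (e ∈? dropped)) (codes-complete e)

  edges-unique : Unique edges
  edges-unique = Unique.filter⁺ (λ e → ¬? (e ∈? dropped)) (codes-unique _)

  edges-∉ : ∀ {e} → e ∈ edges → e ∉ dropped
  edges-∉ e∈ = proj₂ (∈-filter⁻ (λ e → ¬? (e ∈? dropped)) {xs = codes (suc (suc p))} e∈)

  codes-split : codes (suc (suc p)) ↭ dropped ++ edges
  codes-split = unique-↭ (codes-unique _)
    (Unique.++⁺ (Unique.map⁺ (proj₂ ∘ ◃-injective) M-unique) edges-unique (λ (d , e) → edges-∉ e d))
    (λ {c} _ → split c) (λ _ → codes-complete _)
    where
    split : ∀ c → c ∈ dropped ++ edges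
    split c with c ∈? dropped
    ... | yes c∈ = ∈-++⁺ˡ c∈
    ... | no  c∉ = ∈-++⁺ʳ dropped (∈-edges c∉)

  -- The full graph is balanced. So are the deleted edges, which run from `rot x` to `x` with `M`
  -- invariant under `rot`; they cancel.
  edges-balanced : map init edges ↭ map tail edges
  edges-balanced = ++-cancelˡ-↭ dropped-balanced (↭-trans (↭-reflexive (sym (List.map-++ init dropped edges)))
    (↭-trans (map⁺ init (↭-sym codes-split)) (↭-trans codes-balanced
    (↭-trans (map⁺ tail codes-split) (↭-reflexive (List.map-++ tail dropped edges))))))
    where
    dropped-balanced : map init dropped ↭ map tail dropped
    dropped-balanced = ↭-trans (↭-reflexive (trans (sym (List.map-∘ M)) (List.map-cong init-above M)))
      (↭-trans M-rot (↭-reflexive (trans (sym (List.map-id M)) (List.map-∘ M))))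
    codes-balanced : map init (codes (suc (suc p))) ↭ map tail (codes (suc (suc p)))
    -- By definition `init` is `tail` after `rot`, and `rot` permutes all codes.
    codes-balanced = ↭-trans (↭-reflexive (List.map-∘ (codes (suc (suc p))))) (map⁺ tail (rot-codes (suc p)))

  length-edges : length M + length edges ≡ suc (suc p) !
  length-edges = trans (cong (_+ length edges) (sym (List.length-map above M)))
    (trans (sym (List.length-++ dropped)) (trans (sym (↭-length codes-split)) (length-codes (suc (suc p)))))

  -- Deleting `above x` loses no adjacency, because `below x` still joins `rot x` to `x`.
  edges-connected : (P : Code (suc p) → Set) → (∀ {e} → e ∈ edges → P (tail e) → P (init e)) →
    ∀ {v} → P v → ∀ u → P u
  edges-connected P closed = overlap-connected P λ r {x} Px →
    subst (λ s → P (s ◃ init x)) (pinch-punchIn-suc (lastRank x) r) (closed {punchIn (suc (lastRank x)) r ◃ x} (∈-edges (kept r x)) Px)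
    where
    kept : ∀ r x → punchIn (suc (lastRank x)) r ◃ x ∉ dropped
    kept r x e∈ with y , _ , eq ← ∈-map⁻ above e∈ with e , refl ← ◃-injective eq = punchInᵢ≢i _ r e


  -- Spelling a trail as a word

  tied : List (Code (suc (suc p)))
  tied = map below M

  -- below x and above x are covered by the same tied factor, which spells the surviving edge below x.
  data Spelled : Code (suc (suc p)) → Seq → Set where
    strict : ∀ {e w} → Distinct (suc (suc p)) w → code (suc (suc p)) w ≡ e → e ∉ tied → Spelled e w
    tie    : ∀ {x w} → x ∈ M → Distinct (suc p) (w ∘ suc) → code (suc p) (w ∘ suc) ≡ x → w 0 ≡ w (suc p) →
      Spelled (below x) w

  -- Each window of m letters is recorded as distinct, which is what the distance condition rests
  -- on.
  data Spells : List (Code (suc (suc p))) → Seq → Set where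
    []  : ∀ {w} → Distinct (suc p) w → Spells [] w
    _∷_ : ∀ {e t w} → Distinct (suc p) w × Spelled e w → Spells t (w ∘ suc) → Spells (e ∷ t) w

  spelled-double : ∀ {e w} → Spelled e w → Spelled e (λ i → 2 * w i)
  spelled-double {w = w} (strict D eq e∉)  = strict (double-distinct D) (trans (code-double _ w) eq) e∉
  spelled-double {w = w} (tie x∈ D eq w0≡) = tie x∈ (double-distinct D) (trans (code-double _ (w ∘ suc)) eq) (cong (2 *_) w0≡)

  spells-double : ∀ {t w} → Spells t w → Spells t (λ i → 2 * w i)
  spells-double ([] D)        = [] (double-distinct D)
  spells-double ((D , s) ∷ S) = (double-distinct D , spelled-double s) ∷ spells-double S

  open Euler (_≟ᶜ_ {suc p}) (init {suc p}) tail using (Trail; []; _∷_)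

  -- The word grows from right to left. An edge puts one letter in front: a fresh one of the
  -- required rank or, on a tied edge, a copy of the letter that ends up m places to its right.
  spell : ∀ {v z t} → Trail v z t → ∃ λ w → (∀ i → 1 ≤ w i) × Distinct (suc p) w × code (suc p) w ≡ v × Spells t w
  spell {v} [] with w , pos , D , eq ← code-surjective v = w , pos , D , eq , [] D
  spell ((r ◃ x) ∷ q) with w , pos , D , refl , S ← spell q | (r ◃ x) ∈? tied
  ... | no e∉ with b , D′ , eq ← fresh-letter (suc p) D pos r =
    u , (λ { zero → s≤s z≤n ; (suc i) → double-positive pos i }) ,
    distinct-init {w = u} D′ , trans (sym (proj₂ (code-snoc (suc p) {u} D′))) (cong init eq) ,
    (distinct-init {w = u} D′ , strict D′ eq e∉) ∷ spells-double S
    where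
    u : Seq
    u = suc (2 * b) ▹ λ i → 2 * w i
  ... | yes e∈ with y , y∈ , eq ← ∈-map⁻ below e∈ with refl , refl ← ◃-injective eq =
    u , (λ { zero → double-positive pos p ; (suc i) → double-positive pos i }) , Du ,
    trans (code-rot p {u} (double-distinct D) refl)
      (trans (cong rot (code-double (suc p) w)) (sym (init-below _))) ,
    (Du , tie y∈ (double-distinct D) (code-double (suc p) w) refl) ∷ spells-double S
    where
    u : Seq
    u = cycle p (λ i → 2 * w i)
    Du : Distinct (suc p) u
    Du = cycle-distinct p (double-distinct D)

  spells-lookup : ∀ {t w} → Spells t w → ∀ i → Spelled (lookup t i) (λ j → w (toℕ i + j))
  spells-lookup ((_ , s) ∷ S) zero    = s
  spells-lookup (_ ∷ S)       (suc i) = spells-lookup S i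

  -- Equal letters less than m apart would share a window of m distinct letters.
  spells-spread : ∀ {t w i j} → Spells t w → i < j → j < length t + suc p → w i ≡ w j → suc p ≤ j ∸ i
  spells-spread ([] D) i<j j<m eq = ⊥-elim (D i<j j<m eq)
  spells-spread {i = zero} {j} ((D , _) ∷ S) i<j j<N eq with j <? suc p
  ... | yes j<m = ⊥-elim (D i<j j<m eq)
  ... | no  j≮m = ≮⇒≥ j≮m
  spells-spread {i = suc i} {suc j} (_ ∷ S) i<j j<N eq = spells-spread S (s<s⁻¹ i<j) (s<s⁻¹ j<N) eq

  -- The permutations covered by a factor

  merge : Code (suc (suc p)) → Code (suc (suc p))
  merge c with c ∈? dropped
  ... | yes _ = below (tail c)
  ... | no  _ = c

  merge-kept : ∀ {c} → c ∉ dropped → merge c ≡ c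
  merge-kept {c} c∉ with c ∈? dropped
  ... | yes c∈ = ⊥-elim (c∉ c∈)
  ... | no  _  = refl

  merge-above : ∀ {x} → x ∈ M → merge (above x) ≡ below x
  merge-above {x} x∈ with above x ∈? dropped
  ... | yes _ = refl
  ... | no c∉ = ⊥-elim (c∉ (∈-map⁺ above x∈))

  below∉dropped : ∀ {x} → below x ∉ dropped
  below∉dropped e∈ with _ , _ , eq ← ∈-map⁻ above e∈ = below≢above eq

  merge∈edges : ∀ c → merge c ∈ edges
  merge∈edges c with c ∈? dropped
  ... | yes _ = ∈-edges below∉dropped
  ... | no c∉ = ∈-edges c∉

  merge-untied : ∀ {c} → merge c ∉ tied → merge c ≡ c
  merge-untied {c} c∉ with c ∈? dropped
  ... | no _ = refl
  ... | yes c∈ with x , x∈ , refl ← ∈-map⁻ above c∈ = ⊥-elim (c∉ (∈-map⁺ below x∈))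

  merge-tied : ∀ {c x} → merge c ≡ below x → c ≡ below x ⊎ c ≡ above x
  merge-tied {c} eq with c ∈? dropped
  ... | no _ = inj₁ eq
  ... | yes c∈ with y , y∈ , refl ← ∈-map⁻ above c∈ with _ , refl ← ◃-injective eq = inj₂ refl

  module Tie {w : Seq} (D : Distinct (suc p) (w ∘ suc)) (w0≡ : w 0 ≡ w (suc p)) where

    -- The two ways to break the tie: parity puts the head just below or just above the last letter
    -- and preserves all other comparisons.
    lowered raised : Seq
    lowered = 2 * w 0 ▹ λ i → suc (2 * w (suc i))
    raised  = suc (2 * w 0) ▹ λ i → 2 * w (suc i)

    lowered-distinct : Distinct (suc (suc p)) lowered
    lowered-distinct = distinct-▹ (λ {j} _ → even≢odd (w 0) (w (suc j))) (λ i<j j<m eq → double-distinct D i<j j<m (suc-injective eq))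

    raised-distinct : Distinct (suc (suc p)) raised
    raised-distinct = distinct-▹ (λ {j} _ eq → even≢odd (w (suc j)) (w 0) (sym eq)) (double-distinct D)

    lastRank≡ : lastRank (code (suc p) (w ∘ suc)) ≡ rank p (w 0) (w ∘ suc)
    lastRank≡ = trans (proj₁ (code-snoc p {w ∘ suc} D)) (cong (λ a → rank p a (w ∘ suc)) (sym w0≡))

    code-lowered : code (suc (suc p)) lowered ≡ below (code (suc p) (w ∘ suc))
    code-lowered = cong₂ _◃_
      (begin
        rank (suc p) (2 * w 0) (lowered ∘ suc)
          ≡⟨ rank-cong (suc p) {2 * w 0} {w 0} {lowered ∘ suc} {w ∘ suc} (λ _ q → *-cancelˡ-< 2 _ _ (<-trans ≤-refl q)) (λ _ q → odd<even q) ⟩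
        rank (suc p) (w 0) (w ∘ suc)
          ≡⟨ rank-last p (w 0) (w ∘ suc) ⟩
        bump (w (suc p) <? w 0) (rank p (w 0) (w ∘ suc))
          ≡⟨ bump-no (w (suc p) <? w 0) _ (<-irrefl (sym w0≡)) ⟩
        inject₁ (rank p (w 0) (w ∘ suc))
          ≡⟨ cong inject₁ lastRank≡ ⟨
        inject₁ (lastRank (code (suc p) (w ∘ suc))) ∎)
      (code-cong (suc p) {lowered ∘ suc} {w ∘ suc} (λ _ _ q → *-cancelˡ-< 2 _ _ (s<s⁻¹ q)) (λ _ _ q → s≤s (*-monoʳ-< 2 q)))
      where open ≡-Reasoning

    code-raised : code (suc (suc p)) raised ≡ above (code (suc p) (w ∘ suc))
    code-raised = cong₂ _◃_
      (begin
        rank (suc p) (suc (2 * w 0)) (raised ∘ suc)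
          ≡⟨ rank-cong (suc p) {suc (2 * w 0)} {suc (w 0)} {raised ∘ suc} {w ∘ suc}
               (λ _ q → s≤s (*-cancelˡ-≤ 2 (s≤s⁻¹ q))) (λ _ q → s≤s (*-monoʳ-≤ 2 (s≤s⁻¹ q))) ⟩
        rank (suc p) (suc (w 0)) (w ∘ suc)
          ≡⟨ rank-last p (suc (w 0)) (w ∘ suc) ⟩
        bump (w (suc p) <? suc (w 0)) (rank p (suc (w 0)) (w ∘ suc))
          ≡⟨ bump-yes (w (suc p) <? suc (w 0)) _ (s≤s (≤-reflexive (sym w0≡))) ⟩
        suc (rank p (suc (w 0)) (w ∘ suc))
          -- Before the last position no letter equals `w 0`, so the threshold may be lowered by
          -- one.
          ≡⟨ cong suc (rank-cong p (λ j<p q → ≤∧≢⇒< (s≤s⁻¹ q) (λ eq → D j<p ≤-refl (trans eq w0≡))) (λ _ q → m<n⇒m<1+n q)) ⟩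
        suc (rank p (w 0) (w ∘ suc))
          ≡⟨ cong suc lastRank≡ ⟨
        suc (lastRank (code (suc p) (w ∘ suc))) ∎)
      (code-double (suc p) (w ∘ suc))
      where open ≡-Reasoning

    hom-lowered : ∀ {v} → OrderHom (suc (suc p)) lowered v → OrderHom (suc (suc p)) w v
    hom-lowered f {zero}  {zero}  _ _ q = ⊥-elim (<-irrefl refl q)
    hom-lowered f {zero}  {suc j} i< j< q = f i< j< (m<n⇒m<1+n (*-monoʳ-< 2 q))
    hom-lowered f {suc i} {zero}  i< j< q = f i< j< (odd<even q)
    hom-lowered f {suc i} {suc j} i< j< q = f i< j< (s≤s (*-monoʳ-< 2 q))

    hom-raised : ∀ {v} → OrderHom (suc (suc p)) raised v → OrderHom (suc (suc p)) w v
    hom-raised f {zero}  {zero}  _ _ q = ⊥-elim (<-irrefl refl q)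
    hom-raised f {zero}  {suc j} i< j< q = f i< j< (odd<even q)
    hom-raised f {suc i} {zero}  i< j< q = f i< j< (m<n⇒m<1+n (*-monoʳ-< 2 q))
    hom-raised f {suc i} {suc j} i< j< q = f i< j< (*-monoʳ-< 2 q)

    tie-position : ∀ {j} → j < suc p → w (suc j) ≡ w 0 → suc j ≡ suc p
    tie-position {j} j<m eq with <-cmp j p
    ... | tri< j<p _ _ = ⊥-elim (D j<p ≤-refl (trans eq w0≡))
    ... | tri≈ _ j≡p _ = cong suc j≡p
    ... | tri> _ _ p<j = ⊥-elim (<⇒≱ p<j (s≤s⁻¹ j<m))

    -- Breaking the tie adds a single comparison, head against last letter, and the hypothesis on
    -- `v` supplies it.
    lowered-hom : ∀ {v} → OrderHom (suc (suc p)) w v → v 0 < v (suc p) → OrderHom (suc (suc p)) lowered v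
    lowered-hom f lt {zero}  {zero}  _ _ q = ⊥-elim (<-irrefl refl q)
    lowered-hom {v} f lt {zero}  {suc j} i< j< q with m≤n⇒m<n∨m≡n (*-cancelˡ-≤ {w 0} {w (suc j)} 2 (s≤s⁻¹ q))
    ... | inj₁ w0<wj = f i< j< w0<wj
    ... | inj₂ w0≡wj = subst (λ j → v 0 < v j) (sym (tie-position (s<s⁻¹ j<) (sym w0≡wj))) lt
    lowered-hom f lt {suc i} {zero}  i< j< q = f i< j< (*-cancelˡ-< 2 _ _ (<-trans ≤-refl q))
    lowered-hom f lt {suc i} {suc j} i< j< q = f i< j< (*-cancelˡ-< 2 _ _ (s<s⁻¹ q))

    raised-hom : ∀ {v} → OrderHom (suc (suc p)) w v → v (suc p) < v 0 → OrderHom (suc (suc p)) raised v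
    raised-hom f lt {zero}  {zero}  _ _ q = ⊥-elim (<-irrefl refl q)
    raised-hom f lt {zero}  {suc j} i< j< q = f i< j< (*-cancelˡ-< 2 _ _ (<-trans ≤-refl q))
    raised-hom {v} f lt {suc i} {zero} i< j< q with m≤n⇒m<n∨m≡n (*-cancelˡ-≤ {w (suc i)} {w 0} 2 (s≤s⁻¹ q))
    ... | inj₁ wi<w0 = f i< j< wi<w0
    ... | inj₂ wi≡w0 = subst (λ i → v i < v 0) (sym (tie-position (s<s⁻¹ i<) wi≡w0)) lt
    raised-hom f lt {suc i} {suc j} i< j< q = f i< j< (*-cancelˡ-< 2 _ _ q)

  -- A strict factor determines the order type of `v`. Under a tied one `v` may order its ends
  -- either way, and both resulting codes merge to the same edge.
  spelled-sound : ∀ {e w v} → Spelled e w → e ∈ edges → Distinct (suc (suc p)) v →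
    OrderHom (suc (suc p)) w v → merge (code (suc (suc p)) v) ≡ e
  spelled-sound {e} {w} {v} (strict D refl _) e∈ Dv f
    rewrite sym (hom⇒code≡ (suc (suc p)) {w} {v} D f) = merge-kept (edges-∉ e∈)
  spelled-sound {w = w} {v} (tie x∈ D refl w0≡) e∈ Dv f with <-cmp (v 0) (v (suc p))
  ... | tri≈ _ eq _ = ⊥-elim (Dv z<s ≤-refl eq)
  ... | tri< lt _ _ = trans
    (cong merge (trans (sym (hom⇒code≡ _ {lowered} {v} lowered-distinct (lowered-hom {v} f lt))) code-lowered))
    (merge-kept below∉dropped)
    where open Tie {w} D w0≡
  ... | tri> _ _ gt = trans
    (cong merge (trans (sym (hom⇒code≡ _ {raised} {v} raised-distinct (raised-hom {v} f gt))) code-raised))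
    (merge-above x∈)
    where open Tie {w} D w0≡

  -- A code merging to a tied edge is one of the two ways to break the tie, and each refines the
  -- order of `w`; off the tied edges `merge` changes nothing.
  spelled-complete : ∀ {e w v} → Spelled e w → Distinct (suc (suc p)) v →
    merge (code (suc (suc p)) v) ≡ e → OrderHom (suc (suc p)) w v
  spelled-complete {w = w} {v} (strict D eq e∉) Dv m≡ =
    code≡⇒hom _ {w} {v} D Dv (trans eq (trans (sym m≡) (merge-untied (subst (_∉ tied) (sym m≡) e∉))))
  spelled-complete {w = w} {v} (tie x∈ D refl w0≡) Dv m≡ with merge-tied m≡
  ... | inj₁ eq = hom-lowered {v} (code≡⇒hom _ {lowered} {v} lowered-distinct Dv (trans code-lowered (sym eq)))
    where open Tie {w} D w0≡
  ... | inj₂ eq = hom-raised {v} (code≡⇒hom _ {raised} {v} raised-distinct Dv (trans code-raised (sym eq)))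
    where open Tie {w} D w0≡

-- From spellings to u-words

extendℕ : ∀ {n} → (Fin n → ℕ) → Seq
extendℕ {zero}  f _       = 0
extendℕ {suc n} f zero    = f zero
extendℕ {suc n} f (suc i) = extendℕ (f ∘ suc) i

extendℕ-toℕ : ∀ {n} (f : Fin n → ℕ) i → extendℕ f (toℕ i) ≡ f i
extendℕ-toℕ f zero    = refl
extendℕ-toℕ f (suc i) = extendℕ-toℕ (f ∘ suc) i

extendℕ-fromℕ< : ∀ {n} (f : Fin n → ℕ) {i} (i<n : i < n) → extendℕ f i ≡ f (fromℕ< i<n)
extendℕ-fromℕ< f i<n = trans (cong (extendℕ f) (sym (toℕ-fromℕ< i<n))) (extendℕ-toℕ f (fromℕ< i<n))

values : ∀ {n} → Permutation′ n → Seq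
values π = extendℕ (λ i → toℕ (π ⟨$⟩ʳ i))

values-distinct : ∀ {n} (π : Permutation′ n) → Distinct n (values π)
values-distinct π {i} {j} i<j j<n eq = <-irrefl i≡j i<j
  where
  i<n : i < _
  i<n = <-trans i<j j<n
  π-eq : π ⟨$⟩ʳ fromℕ< i<n ≡ π ⟨$⟩ʳ fromℕ< j<n
  π-eq = toℕ-injective (trans (sym (extendℕ-fromℕ< _ i<n)) (trans eq (extendℕ-fromℕ< _ j<n)))
  i≡j : i ≡ j
  i≡j = trans (sym (toℕ-fromℕ< i<n)) (trans
    (cong toℕ (trans (sym (inverseˡ π)) (trans (cong (π ⟨$⟩ˡ_) π-eq) (inverseˡ π)))) (toℕ-fromℕ< j<n))

lookup-factor : ∀ {n N} (n≤N : n ≤ N) (w : Seq) i (j : Fin n) →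
  Vec.lookup (factor n≤N (tabulate (w ∘ toℕ)) i) j ≡ w (toℕ i + toℕ j)
lookup-factor n≤N w i j = trans (lookup∘tabulate _ j)
  (trans (lookup∘tabulate (w ∘ toℕ) _) (cong w (toℕ-fromℕ< (factor-bound n≤N i j))))

module _ {n N} (n≤N : n ≤ N) (w : Seq) (i : Fin (suc (N ∸ n))) (π : Permutation′ n) where

  covers⇒hom : Covers (factor n≤N (tabulate (w ∘ toℕ)) i) π → OrderHom n (λ j → w (toℕ i + j)) (values π)
  covers⇒hom cov {a} {b} a<n b<n lt = subst₂ _<_ (sym (extendℕ-fromℕ< _ a<n)) (sym (extendℕ-fromℕ< _ b<n))
    (cov (fromℕ< a<n) (fromℕ< b<n) (subst₂ _<_ (letter a<n) (letter b<n) lt))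
    where
    letter : ∀ {a} (a<n : a < n) → w (toℕ i + a) ≡ Vec.lookup (factor n≤N (tabulate (w ∘ toℕ)) i) (fromℕ< a<n)
    letter a<n = sym (trans (lookup-factor n≤N w i (fromℕ< a<n)) (cong (λ a → w (toℕ i + a)) (toℕ-fromℕ< a<n)))

  hom⇒covers : OrderHom n (λ j → w (toℕ i + j)) (values π) → Covers (factor n≤N (tabulate (w ∘ toℕ)) i) π
  hom⇒covers f a b lt = subst₂ _<_ (extendℕ-toℕ _ a) (extendℕ-toℕ _ b)
    (f (toℕ<n a) (toℕ<n b) (subst₂ _<_ (lookup-factor n≤N w i a) (lookup-factor n≤N w i b) lt))

-- The count stays additive over ℕ; only here does the possibly negative factor 1 - k appear.
integer-length : ∀ {N f m k} → m * k + N ≡ f + m → + N ≡ + f +ℤ (1ℤ -ℤ + k) *ℤ + m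
integer-length {N} {f} {m} {k} eq = begin
  + N                                   ≡⟨ rearrange (+ m) (+ k) (+ N) ⟩
  (+ m *ℤ + k +ℤ + N) -ℤ + m *ℤ + k     ≡⟨ cong (λ z → z +ℤ + N -ℤ + m *ℤ + k) (ℤ.pos-* m k) ⟨
  + (m * k + N) -ℤ + m *ℤ + k           ≡⟨ cong (λ z → + z -ℤ + m *ℤ + k) eq ⟩
  + f +ℤ + m -ℤ + m *ℤ + k              ≡⟨ collect (+ f) (+ m) (+ k) ⟩
  + f +ℤ (1ℤ -ℤ + k) *ℤ + m             ∎
  where
  open ≡-Reasoning
  rearrange : ∀ m k N → N ≡ (m *ℤ k +ℤ N) -ℤ m *ℤ k
  rearrange = ℤ-Solver.solve-∀
  collect : ∀ f m k → f +ℤ m -ℤ m *ℤ k ≡ f +ℤ (1ℤ -ℤ k) *ℤ m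
  collect = ℤ-Solver.solve-∀

module _ {p : ℕ} {M : List (Code (suc p))} (M-unique : Unique M) (M-rot : map rot M ↭ M) where

  open Merged M M-unique M-rot
  open Euler (_≟ᶜ_ {suc p}) (init {suc p}) tail using (circuit)

  module FromSpelling {t w} (t↭ : t ↭ edges) (pos : ∀ i → 1 ≤ w i) (S : Spells t w) where

    N : ℕ
    N = length t + suc p

    u : Word N
    u = tabulate (w ∘ toℕ)

    t-unique : Unique t
    t-unique = PermutationSetoid.Unique-resp-↭ (setoid _) (↭⇒↭ₛ (↭-sym t↭)) edges-unique

    merge∈t : ∀ c → merge c ∈ t
    merge∈t c = ∈-resp-↭ (↭-sym t↭) (merge∈edges c)

    n≤N : suc (suc p) ≤ N
    -- The circuit is nonempty, since it contains the edge of any code; that of `id` is an arbitrary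
    -- choice.
    n≤N = +-monoˡ-≤ (suc p) (≤-trans z<s (toℕ<n (index (merge∈t (code (suc (suc p)) id)))))

    -- One factor per edge: the m further letters of the word belong to the final vertex.
    factors≡ : suc (N ∸ suc (suc p)) ≡ length t
    factors≡ = trans (sym (+-∸-assoc 1 n≤N)) (m+n∸n≡m (length t) (suc p))

    module _ (π : Permutation′ (suc (suc p))) where

      c : Code (suc (suc p))
      c = code (suc (suc p)) (values π)

      i₀ : Fin (length t)
      i₀ = index (merge∈t c)

      covered : Covers (factor n≤N u (cast (sym factors≡) i₀)) π
      covered = hom⇒covers n≤N w (cast (sym factors≡) i₀) π
        (subst (λ i → OrderHom (suc (suc p)) (λ j → w (i + j)) (values π)) (sym (toℕ-cast (sym factors≡) i₀))
          (spelled-complete {v = values π} (spells-lookup S i₀) (values-distinct π) (lookup-index (merge∈t c))))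

      -- A factor covering π must spell the edge `merge c`, and the circuit uses each edge once.
      covered-once : ∀ {i} → Covers (factor n≤N u i) π → cast (sym factors≡) i₀ ≡ i
      covered-once {i} cov = toℕ-injective (begin
        toℕ (cast (sym factors≡) i₀) ≡⟨ toℕ-cast (sym factors≡) i₀ ⟩
        toℕ i₀                       ≡⟨ cong toℕ (lookup-unique t-unique i₀ i₁ (trans (sym (lookup-index (merge∈t c))) merge≡)) ⟩
        toℕ i₁                       ≡⟨ toℕ-cast factors≡ i ⟩
        toℕ i                        ∎)
        where
        open ≡-Reasoning
        i₁ : Fin (length t)
        i₁ = cast factors≡ i
        merge≡ : merge c ≡ lookup t i₁
        merge≡ = spelled-sound {v = values π} (spells-lookup S i₁) (∈-resp-↭ t↭ (∈-lookup i₁)) (values-distinct π)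
          (subst (λ i → OrderHom (suc (suc p)) (λ j → w (i + j)) (values π)) (sym (toℕ-cast factors≡ i)) (covers⇒hom n≤N w i π cov))

    isUWord : IsUWord (suc (suc p)) u
    isUWord = VecAll.tabulate⁺ (λ i → pos (toℕ i)) , n≤N , λ π → cast (sym factors≡) (i₀ π) , covered π , covered-once π

    spread : IncomparableAtDistance (suc p) u
    spread i j i<j eq = spells-spread S i<j (toℕ<n j)
      (trans (sym (lookup∘tabulate (w ∘ toℕ) i)) (trans eq (lookup∘tabulate (w ∘ toℕ) j)))

    length≡ : length M + N ≡ suc (suc p) ! + suc p
    length≡ = trans (sym (+-assoc (length M) (length t) (suc p)))
      (cong (_+ suc p) (trans (cong (λ l → length M + l) (↭-length t↭)) length-edges))

  u-word : Σ[ N ∈ ℕ ] Σ[ u ∈ Word N ]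
    (IsUWord (suc (suc p)) u × IncomparableAtDistance (suc p) u × length M + N ≡ suc (suc p) ! + suc p)
  u-word =
    let _ , t , trail , t↭  = circuit edges edges-connected (code (suc p) id) edges-balanced
        w , pos , _ , _ , S = spell trail
        open FromSpelling t↭ pos S
    in N , u , isUWord , spread , length≡

-- Choosing k cycles

length-orbits : ∀ {p k} → k ≤ p ! → length (orbits (take k (codes p))) ≡ suc p * k
length-orbits {p} {k} k≤p! = trans (length-cartesianProductWith orbit (allFin (suc p)) (take k (codes p)))
  (cong₂ _*_ (List.length-tabulate {n = suc p} id)
    (trans (List.length-take k (codes p)) (m≤n⇒m⊓n≡m (subst (k ≤_) (sym (length-codes p)) k≤p!))))

theorem1 : (n : ℕ) → 2 ≤ n → (k : ℕ) → k ≤ (n ∸ 2) ! →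
    Σ[ N ∈ ℕ ] Σ[ u ∈ Word N ]
    (IsUWord n u
    × IncomparableAtDistance (n ∸ 1) u
    × + N ≡ + (n !) +ℤ (1ℤ -ℤ + k) *ℤ (+ n -ℤ 1ℤ))
theorem1 (suc zero)    (s≤s ())
theorem1 (suc (suc p)) _ k k≤p! =
  -- The first k codes of p letters represent the k cycles along which edges are merged.
  let reps-unique = Unique.take⁺ k (codes-unique p)
      N , u , isUWord , spread , length≡ = u-word (orbits-unique reps-unique) (rot-orbits reps-unique)
  in N , u , isUWord , spread ,
     integer-length {N} {suc (suc p) !} {suc p} {k} (trans (cong (_+ N) (sym (length-orbits k≤p!))) length≡)
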